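{- Let $(F; +, \cdot, <)$ be an ordered field such that $T = \mathrm{Th}(F;+,\cdot,<)$ is dp-small. Then every positive element of $F$ has an $n$th root in $F$ for every positive integer $n$.
   Context: For a complete theory $T$ in language $L$ with monster model $\mathcal{U}$ ($\mathcal{U}_y$ the $|y|$-tuples from $\mathcal{U}$): a partial type $\pi(x)$ is dp-small if there do not exist $L(\mathcal{U})$-formulas $\varphi_i(x)$ ($i<\omega$), an $L$-formula $\psi(x;y)$ and $b_j\in\mathcal{U}_y$ ($j<\omega$) such that for all $i_0,j_0<\omega$ the type $\pi(x)\cup\{\varphi_{i_0}(x),\psi(x;b_{j_0})\}\cup\{\neg\varphi_i(x): i\ne i_0\}\cup\{\neg\psi(x;b_j): j\neq j_0\}$ is consistent. $T$ is dp-small if $x=x$ is dp-small for $x$ a single variable. -}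

module Defs where

open import Algebra.Bundles using (CommutativeRing)
open import Data.Fin using (Fin; zero)
open import Data.List.Relation.Unary.All using (All)
open import Data.Nat using (ℕ; suc; _+_)
open import Data.Product using (Σ; ∃; _×_; _,_)
open import Data.Sum using (_⊎_)
open import Data.Vec using (Vec; []; _∷_; _++_; lookup; map)
open import Data.Vec.Relation.Binary.Pointwise.Inductive using (Pointwise; []; _∷_)
open import Function.Bundles using (Inverse; _⇔_)
open import Level using (Level; Lift; _⊔_) renaming (suc to lsuc)
open import Relation.Binary.Bundles using (Setoid)
open import Relation.Binary.Core using (Rel)
open import Relation.Binary.PropositionalEquality using (_≡_; _≢_)
open import Relation.Binary.Structures using (IsStrictTotalOrder)
open import Relation.Nullary using (¬_)
open import Relation.Unary using (Pred; _∪_; ｛_｝)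

private
  variable
    a c ℓ r p s t : Level
    k n : ℕ

record Language : Set₁ where
  field
    Func   : ℕ → Set
    Relsym : ℕ → Set

-- The free variables are among the de Bruijn indices `Fin n`; under a
-- quantifier, index 0 is the bound variable.
data Term (L : Language) (n : ℕ) : Set where
  var  : Fin n → Term L n
  func : Language.Func L k → Vec (Term L n) k → Term L n

infix  7 _≐_
infixr 6 _∧'_
infixr 5 _∨'_
infixr 4 _⇒'_

data Formula (L : Language) (n : ℕ) : Set where
  _≐_            : Term L n → Term L n → Formula L n
  rel            : Language.Relsym L k → Vec (Term L n) k → Formula L n
  ¬'_            : Formula L n → Formula L n
  _∧'_ _∨'_ _⇒'_ : Formula L n → Formula L n → Formula L n
  ∀'_ ∃'_        : Formula L (suc n) → Formula L n

Sentence : Language → Set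
Sentence L = Formula L 0

Theory : Language → (t : Level) → Set (lsuc t)
Theory L t = Pred (Sentence L) t

-- The equality symbol is interpreted by the equality of the carrier
-- setoid, i.e. the setoid stands for its quotient.
record Structure (L : Language) (c ℓ r : Level) : Set (lsuc (c ⊔ ℓ ⊔ r)) where
  open Language L
  field
    setoid : Setoid c ℓ
  open Setoid setoid public using (Carrier; _≈_)
  field
    ⟦_⟧ᶠ   : Func k → Vec Carrier k → Carrier
    ⟦_⟧ʳ   : Relsym k → Vec Carrier k → Set r
    ᶠ-cong : ∀ (f : Func k) {xs ys} → Pointwise _≈_ xs ys → ⟦ f ⟧ᶠ xs ≈ ⟦ f ⟧ᶠ ys
    ʳ-resp : ∀ (R : Relsym k) {xs ys} → Pointwise _≈_ xs ys → ⟦ R ⟧ʳ xs → ⟦ R ⟧ʳ ys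

module _ {L : Language} (M : Structure L c ℓ r) where
  open Structure M

  eval  : Vec Carrier n → Term L n → Carrier
  evals : Vec Carrier n → Vec (Term L n) k → Vec Carrier k
  eval ρ (var i)     = lookup ρ i
  eval ρ (func f ts) = ⟦ f ⟧ᶠ (evals ρ ts)
  evals ρ []         = []
  evals ρ (t ∷ ts)   = eval ρ t ∷ evals ρ ts

  Sat : Formula L n → Vec Carrier n → Set (c ⊔ ℓ ⊔ r)
  Sat (t ≐ u)    ρ = Lift (c ⊔ r) (eval ρ t ≈ eval ρ u)
  Sat (rel R ts) ρ = Lift (c ⊔ ℓ) (⟦ R ⟧ʳ (evals ρ ts))
  Sat (¬' φ)     ρ = ¬ Sat φ ρ
  Sat (φ ∧' χ)   ρ = Sat φ ρ × Sat χ ρ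
  Sat (φ ∨' χ)   ρ = Sat φ ρ ⊎ Sat χ ρ
  Sat (φ ⇒' χ)   ρ = Sat φ ρ → Sat χ ρ
  Sat (∀' φ)     ρ = ∀ x → Sat φ (x ∷ ρ)
  Sat (∃' φ)     ρ = ∃ λ x → Sat φ (x ∷ ρ)

  Th : Theory L (c ⊔ ℓ ⊔ r)
  Th σ = Sat σ []

  Models : Theory L t → Set (c ⊔ ℓ ⊔ r ⊔ t)
  Models T = ∀ {σ} → T σ → Sat σ []

  record Automorphism : Set (c ⊔ ℓ ⊔ r) where
    field
      bijection : Inverse setoid setoid
    open Inverse bijection public using (to)
    field
      to-func : ∀ (f : Language.Func L k) xs → to (⟦ f ⟧ᶠ xs) ≈ ⟦ f ⟧ᶠ (map to xs)
      to-rel  : ∀ (R : Language.Relsym L k) xs → ⟦ R ⟧ʳ xs ⇔ ⟦ R ⟧ʳ (map to xs)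

-- A formula φ(x₀,…,xₖ₋₁; a₁,…,aₘ) whose parameters aᵢ are elements (or
-- names of elements) in A; in φ the variables x precede the parameter
-- places.  For A the carrier of M these are the L(M)-formulas in k
-- free variables.
record FormulaOver (L : Language) (A : Set a) (k : ℕ) : Set a where
  constructor _⟨_⟩
  field
    {arity} : ℕ
    formula : Formula L (k + arity)
    params  : Vec A arity

neg : {L : Language} {A : Set a} → FormulaOver L A k → FormulaOver L A k
neg (φ ⟨ as ⟩) = (¬' φ) ⟨ as ⟩

PartialType : (L : Language) (A : Set a) (k : ℕ) (p : Level) → Set (a ⊔ lsuc p)
PartialType L A k p = Pred (FormulaOver L A k) p

module _ {L : Language} (M : Structure L c ℓ r) where
  open Structure M

  Satisfies : Vec Carrier k → FormulaOver L Carrier k → Set (c ⊔ ℓ ⊔ r)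
  Satisfies x (φ ⟨ as ⟩) = Sat M φ (x ++ as)

  Realizes : Vec Carrier k → PartialType L Carrier k p → Set (c ⊔ ℓ ⊔ r ⊔ p)
  Realizes x π = ∀ {χ} → π χ → Satisfies x χ

  -- A type over M is consistent (with the elementary diagram of M) when
  -- each of its finite parts is satisfied in M.
  Consistent : PartialType L Carrier k p → Set (c ⊔ ℓ ⊔ r ⊔ p)
  Consistent π = ∀ Γ → All π Γ → ∃ λ x → All (Satisfies x) Γ

  -- The type over M obtained by reading the names in A via v.
  instantiate : {A : Set a} → (A → Carrier) → PartialType L A k p →
                PartialType L Carrier k (a ⊔ c ⊔ p)
  instantiate v π χ = ∃ λ ξ → π ξ ×
    χ ≡ FormulaOver.formula ξ ⟨ map v (FormulaOver.params ξ) ⟩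

-- A parameter set is small when it is indexed by a
-- type in `Set s`; thus "small" means "of cardinality less than κ" for
-- κ the (strongly inaccessible) size of that universe.  The last two
-- fields are κ-saturation and strong κ-homogeneity.
record MonsterModel {L : Language} (T : Theory L t) (s c ℓ r : Level)
       : Set (t ⊔ lsuc (s ⊔ c ⊔ ℓ ⊔ r)) where
  field
    structure : Structure L c ℓ r
    models    : Models structure T
  open Structure structure public
  field
    saturated   : {A : Set s} (v : A → Carrier) (π : PartialType L A k s) →
                  Consistent structure (instantiate structure v π) →
                  ∃ λ x → Realizes structure x (instantiate structure v π)
    homogeneous : {A : Set s} (v w : A → Carrier) →
                  (∀ {m} (φ : Formula L m) (as : Vec A m) →
                     Sat structure φ (map v as) ⇔ Sat structure φ (map w as)) →
                  Σ (Automorphism structure) λ σ →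
                    ∀ i → Automorphism.to σ (v i) ≈ w i

module _ {L : Language} {T : Theory L t} (𝒰 : MonsterModel T s c ℓ r) where
  open MonsterModel 𝒰

  record DpPattern (π : PartialType L Carrier k p) : Set (c ⊔ ℓ ⊔ r ⊔ p) where
    field
      φ    : ℕ → FormulaOver L Carrier k
      {|y|} : ℕ
      ψ    : Formula L (k + |y|)
      b    : ℕ → Vec Carrier |y|
      consistent : ∀ i₀ j₀ → Consistent structure
        ( π
        ∪ ｛ φ i₀ ｝
        ∪ ｛ ψ ⟨ b j₀ ⟩ ｝
        ∪ (λ χ → ∃ λ i → i ≢ i₀ × χ ≡ neg (φ i))
        ∪ (λ χ → ∃ λ j → j ≢ j₀ × χ ≡ neg (ψ ⟨ b j ⟩)))

  DpSmallType : PartialType L Carrier k p → Set (c ⊔ ℓ ⊔ r ⊔ p)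
  DpSmallType π = ¬ DpPattern π

  -- The property of T itself: the type x = x in a single variable,
  -- computed in the monster model 𝒰 of T.
  DpSmall : Set (c ⊔ ℓ ⊔ r)
  DpSmall = DpSmallType {k = 1} ｛ (var zero ≐ var zero) ⟨ [] ⟩ ｝

record OrderedField (c ℓ r : Level) : Set (lsuc (c ⊔ ℓ ⊔ r)) where
  infix 4 _<_
  field
    commutativeRing : CommutativeRing c ℓ
  open CommutativeRing commutativeRing public renaming (_+_ to _⊕_; _*_ to _⊗_)
  field
    0≉1      : ¬ (0# ≈ 1#)
    inverse  : ∀ x → ¬ (x ≈ 0#) → ∃ λ y → x ⊗ y ≈ 1#
    _<_      : Rel Carrier r
    isStrictTotalOrder : IsStrictTotalOrder _≈_ _<_
    +-mono-< : ∀ {x y} z → x < y → x ⊕ z < y ⊕ z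
    *-pos    : ∀ {x y} → 0# < x → 0# < y → 0# < x ⊗ y

  open import Algebra.Properties.Semiring.Exp
    (CommutativeRing.semiring commutativeRing) public using (_^_)

data OFFunc : ℕ → Set where
  plus times : OFFunc 2

data OFRel : ℕ → Set where
  less : OFRel 2

Lₒᵣ : Language
Lₒᵣ = record { Func = OFFunc ; Relsym = OFRel }

orderedFieldStructure : OrderedField c ℓ r → Structure Lₒᵣ c ℓ r
orderedFieldStructure F = record
  { setoid = setoid
  ; ⟦_⟧ᶠ   = λ { plus (x ∷ y ∷ []) → x ⊕ y ; times (x ∷ y ∷ []) → x ⊗ y }
  ; ⟦_⟧ʳ   = λ { less (x ∷ y ∷ []) → x < y }
  ; ᶠ-cong = λ { plus  (p ∷ q ∷ []) → +-cong p q
               ; times (p ∷ q ∷ []) → *-cong p q }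
  ; ʳ-resp = λ { less (p ∷ q ∷ []) x<y →
                 <-respʳ-≈ q (<-respˡ-≈ p x<y) }
  }
  where
  open OrderedField F
  open IsStrictTotalOrder isStrictTotalOrder using (<-respʳ-≈; <-respˡ-≈)

{-# OPTIONS --safe #-}
module Submission where

-- If some positive element has no n-th root, then multiplying it by a large
-- n-th power gives such an element a with 1 < a.  Say that x > 0 has depth i
-- when it is an nⁱ-th power but not an nⁱ⁺¹-th power of a positive element;
-- distinct depths are disjoint.  For b > a the element (a bⁿ)^(nⁱ) has depth i
-- and lies between b and b^((n+1) nⁱ), and both facts transfer from F to 𝒰 as
-- first-order sentences.  By saturation there are b₀ < b₁ < … above a with bⱼ₊₁
-- beyond every power of bⱼ, so each interval (bⱼ , bⱼ₊₁) contains elements of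
-- every depth: depths and intervals form a pattern contradicting dp-smallness.

open import Defs
open import Axiom.ExcludedMiddle using (ExcludedMiddle)
open import Data.Nat using (ℕ; NonZero)
open import Data.Product using (∃)

import Algebra.Properties.CommutativeSemigroup as CommutativeSemigroupProperties
import Algebra.Properties.CommutativeSemiring.Exp as Exp
import Algebra.Properties.Ring as RingProperties
open import Data.Fin using (zero; suc)
open import Data.List using ([]; _∷_)
open import Data.List.Relation.Unary.All as All using (All; []; _∷_)
open import Data.Nat as ℕ using (zero; suc)
open import Data.Nat.Divisibility using (_∣_; divides)
import Data.Nat.Properties as ℕ
open import Data.Product using (_×_; _,_; proj₁; proj₂)
open import Data.Sum using (inj₁; inj₂)
open import Data.Unit using (⊤; tt)
open import Data.Vec using (Vec; []; _∷_)
open import Function.Base using (_∘_)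
open import Function.Bundles using (_⇔_; mk⇔; Equivalence)
open import Level using (Level; Lift; lift; lower; _⊔_)
open import Relation.Binary.Bundles using (Setoid; StrictPartialOrder)
open import Relation.Binary.Definitions using (tri<; tri≈; tri>)
import Relation.Binary.PropositionalEquality as ≡
open ≡ using (_≡_; _≢_)
import Relation.Binary.Reasoning.StrictPartialOrder as <-Reasoning
open import Relation.Binary.Structures using (IsStrictTotalOrder)
open import Relation.Nullary using (¬_; yes; no; contradiction)
open import Relation.Unary using (｛_｝)

private
  variable
    c ℓ r c′ ℓ′ r′ s : Level
    m m′ : ℕ

^-monoʳ-∣ : ∀ n {i j} → i ℕ.≤ j → n ℕ.^ i ∣ n ℕ.^ j
^-monoʳ-∣ n {i} {j} i≤j = divides (n ℕ.^ (j ℕ.∸ i)) (begin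
  n ℕ.^ j                        ≡⟨ ≡.cong (n ℕ.^_) (ℕ.m∸n+n≡m i≤j) ⟨
  n ℕ.^ (j ℕ.∸ i ℕ.+ i)          ≡⟨ ℕ.^-distribˡ-+-* n (j ℕ.∸ i) i ⟩
  n ℕ.^ (j ℕ.∸ i) ℕ.* n ℕ.^ i    ∎)
  where open ≡.≡-Reasoning

-- Order and powers in an ordered field.

module OrderedFieldProperties (F : OrderedField c ℓ r) where
  open OrderedField F
  open IsStrictTotalOrder isStrictTotalOrder
    using (compare; irrefl; isStrictPartialOrder; <-respʳ-≈; <-respˡ-≈)
    renaming (trans to <-trans; asym to <-asym) public
  open Exp commutativeSemiring using (^-congˡ; ^-assocʳ; ^-distrib-*) public
  open RingProperties ring using (-‿distribˡ-*; -‿distribʳ-*; -‿involutive)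
  open CommutativeSemigroupProperties *-commutativeSemigroup using (x∙yz≈y∙xz)

  strictPartialOrder : StrictPartialOrder c ℓ r
  strictPartialOrder = record { isStrictPartialOrder = isStrictPartialOrder }

  open <-Reasoning strictPartialOrder

  +-monoʳ-< : ∀ z {x y} → x < y → z ⊕ x < z ⊕ y
  +-monoʳ-< z {x} {y} x<y = begin-strict
    z ⊕ x  ≈⟨ +-comm z x ⟩
    x ⊕ z  <⟨ +-mono-< z x<y ⟩
    y ⊕ z  ≈⟨ +-comm y z ⟩
    z ⊕ y  ∎

  x<x+y : ∀ x {y} → 0# < y → x < x ⊕ y
  x<x+y x 0<y = <-respˡ-≈ (+-identityʳ x) (+-monoʳ-< x 0<y)

  0<⇒x<x+x : ∀ {x} → 0# < x → x < x ⊕ x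
  0<⇒x<x+x {x} = x<x+y x

  x<x+x⇒0< : ∀ {x} → x < x ⊕ x → 0# < x
  x<x+x⇒0< {x} x<x+x = begin-strict
    0#              ≈⟨ -‿inverseʳ x ⟨
    x ⊕ - x         <⟨ +-mono-< (- x) x<x+x ⟩
    (x ⊕ x) ⊕ - x   ≈⟨ +-assoc x x (- x) ⟩
    x ⊕ (x ⊕ - x)   ≈⟨ +-congˡ (-‿inverseʳ x) ⟩
    x ⊕ 0#          ≈⟨ +-identityʳ x ⟩
    x               ∎

  x<y⇒0<y-x : ∀ {x y} → x < y → 0# < y ⊕ - x
  x<y⇒0<y-x {x} x<y = <-respˡ-≈ (-‿inverseʳ x) (+-mono-< (- x) x<y)

  x<0⇒0<-x : ∀ {x} → x < 0# → 0# < - x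
  x<0⇒0<-x {x} x<0 = <-respʳ-≈ (+-identityˡ (- x)) (x<y⇒0<y-x x<0)

  0<1 : 0# < 1#
  0<1 with compare 0# 1#
  ... | tri< 0<1 _ _   = 0<1
  ... | tri≈ _ 0≈1 _   = contradiction 0≈1 0≉1
  ... | tri> _ _ 1<0 = begin-strict
    0#             <⟨ *-pos 0<-1 0<-1 ⟩
    - 1# ⊗ - 1#    ≈⟨ -‿distribˡ-* 1# (- 1#) ⟨
    - (1# ⊗ - 1#)  ≈⟨ -‿cong (*-identityˡ (- 1#)) ⟩
    - - 1#         ≈⟨ -‿involutive 1# ⟩
    1#             ∎
    where 0<-1 = x<0⇒0<-x 1<0

  *-monoˡ-< : ∀ {z x y} → 0# < z → x < y → x ⊗ z < y ⊗ z
  *-monoˡ-< {z} {x} {y} 0<z x<y = begin-strict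
    x ⊗ z                      ≈⟨ +-identityˡ (x ⊗ z) ⟨
    0# ⊕ x ⊗ z                 <⟨ +-mono-< (x ⊗ z) (*-pos (x<y⇒0<y-x x<y) 0<z) ⟩
    (y ⊕ - x) ⊗ z ⊕ x ⊗ z      ≈⟨ distribʳ z (y ⊕ - x) x ⟨
    ((y ⊕ - x) ⊕ x) ⊗ z        ≈⟨ *-congʳ (+-assoc y (- x) x) ⟩
    (y ⊕ (- x ⊕ x)) ⊗ z        ≈⟨ *-congʳ (+-congˡ (-‿inverseˡ x)) ⟩
    (y ⊕ 0#) ⊗ z               ≈⟨ *-congʳ (+-identityʳ y) ⟩
    y ⊗ z                      ∎

  *-monoʳ-< : ∀ {z x y} → 0# < z → x < y → z ⊗ x < z ⊗ y
  *-monoʳ-< {z} {x} {y} 0<z x<y = begin-strict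
    z ⊗ x  ≈⟨ *-comm z x ⟩
    x ⊗ z  <⟨ *-monoˡ-< 0<z x<y ⟩
    y ⊗ z  ≈⟨ *-comm y z ⟩
    z ⊗ y  ∎

  y<x*y : ∀ {x y} → 1# < x → 0# < y → y < x ⊗ y
  y<x*y {y = y} 1<x 0<y = <-respˡ-≈ (*-identityˡ y) (*-monoˡ-< 0<y 1<x)

  x<x*x⇒1< : ∀ {x} → 0# < x → x < x ⊗ x → 1# < x
  x<x*x⇒1< {x} 0<x x<x*x with compare 1# x
  ... | tri< 1<x _ _ = 1<x
  ... | tri≈ _ 1≈x _ =
    contradiction x<x*x (irrefl (trans (sym (*-identityˡ x)) (*-congʳ 1≈x)))
  ... | tri> _ _ x<1 =
    contradiction x<x*x (<-asym (<-respʳ-≈ (*-identityˡ x) (*-monoˡ-< 0<x x<1)))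

  0<x*y⇒0<y : ∀ {x y} → 0# < x → 0# < x ⊗ y → 0# < y
  0<x*y⇒0<y {x} {y} 0<x 0<xy with compare 0# y
  ... | tri< 0<y _ _ = 0<y
  ... | tri≈ _ 0≈y _ = contradiction 0<xy (irrefl (trans (sym (zeroʳ x)) (*-congˡ 0≈y)))
  ... | tri> _ _ y<0 = contradiction 0<xy (<-asym (<-respʳ-≈ (zeroʳ x) (*-monoʳ-< 0<x y<0)))

  pos-inverse : ∀ {x} → 0# < x → ∃ λ y → 0# < y × x ⊗ y ≈ 1#
  pos-inverse {x} 0<x with inverse x (λ x≈0 → irrefl (sym x≈0) 0<x)
  ... | y , xy≈1 = y , 0<x*y⇒0<y 0<x (<-respʳ-≈ (sym xy≈1) 0<1) , xy≈1

  upward-directed : ∀ x y → ∃ λ z → x < z × y < z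
  upward-directed x y with compare x y
  ... | tri< x<y _ _ = y ⊕ 1# , <-trans x<y (x<x+y y 0<1) , x<x+y y 0<1
  ... | tri≈ _ x≈y _ = y ⊕ 1# , <-respˡ-≈ (sym x≈y) (x<x+y y 0<1) , x<x+y y 0<1
  ... | tri> _ _ y<x = x ⊕ 1# , x<x+y x 0<1 , <-trans y<x (x<x+y x 0<1)

  ^-pos : ∀ {x} k → 0# < x → 0# < x ^ k
  ^-pos zero    0<x = 0<1
  ^-pos (suc k) 0<x = *-pos 0<x (^-pos k 0<x)

  ^-mono-< : ∀ k .{{_ : NonZero k}} {x y} → 0# < x → x < y → x ^ k < y ^ k
  ^-mono-< (suc zero) {x} {y} 0<x x<y = begin-strict
    x ⊗ 1#  ≈⟨ *-identityʳ x ⟩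
    x       <⟨ x<y ⟩
    y       ≈⟨ *-identityʳ y ⟨
    y ⊗ 1#  ∎
  ^-mono-< (suc k@(suc _)) {x} {y} 0<x x<y = begin-strict
    x ⊗ x ^ k  <⟨ *-monoˡ-< (^-pos k 0<x) x<y ⟩
    y ⊗ x ^ k  <⟨ *-monoʳ-< (<-trans 0<x x<y) (^-mono-< k 0<x x<y) ⟩
    y ⊗ y ^ k  ∎

  ^-injective : ∀ k .{{_ : NonZero k}} {x y} → 0# < x → 0# < y → x ^ k ≈ y ^ k → x ≈ y
  ^-injective k {x} {y} 0<x 0<y xᵏ≈yᵏ with compare x y
  ... | tri< x<y _ _ = contradiction (^-mono-< k 0<x x<y) (irrefl xᵏ≈yᵏ)
  ... | tri≈ _ x≈y _ = x≈y
  ... | tri> _ _ y<x = contradiction (^-mono-< k 0<y y<x) (irrefl (sym xᵏ≈yᵏ))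

  <-*-^ : ∀ k .{{_ : NonZero k}} {x y z} → 1# < x → 0# < y → z < y ⊗ x → z < y ⊗ x ^ k
  <-*-^ (suc zero) {x} 1<x 0<y z<yx = <-respʳ-≈ (*-congˡ (sym (*-identityʳ x))) z<yx
  <-*-^ (suc k@(suc _)) {x} {y} {z} 1<x 0<y z<yx = begin-strict
    z                <⟨ <-*-^ k 1<x 0<y z<yx ⟩
    y ⊗ x ^ k        <⟨ y<x*y 1<x (*-pos 0<y (^-pos k (<-trans 0<1 1<x))) ⟩
    x ⊗ (y ⊗ x ^ k)  ≈⟨ x∙yz≈y∙xz x y (x ^ k) ⟩
    y ⊗ (x ⊗ x ^ k)  ∎

  <-^ : ∀ k .{{_ : NonZero k}} {x z} → 1# < x → z < x → z < x ^ k
  <-^ k {x} {z} 1<x z<x =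
    <-respʳ-≈ (*-identityˡ (x ^ k))
      (<-*-^ k 1<x 0<1 (<-respʳ-≈ (sym (*-identityˡ x)) z<x))

  -- Positive roots and depth.

  HasPosRoot : ℕ → Carrier → Set (c ⊔ ℓ ⊔ r)
  HasPosRoot k x = ∃ λ y → 0# < y × y ^ k ≈ x

  HasPosRoot-∣ : ∀ {k l x} → k ∣ l → HasPosRoot l x → HasPosRoot k x
  HasPosRoot-∣ {k} (divides q ≡.refl) (y , 0<y , yˡ≈x) =
    y ^ q , ^-pos q 0<y , trans (^-assocʳ y q k) yˡ≈x

  -- The root is `z` divided by `b`. Hence a non-power remains one after multiplication by a `k`th
  -- power, which allows elements to be enlarged freely.
  divide-root : ∀ k {x b z} → 0# < b → z ^ k ≈ x ⊗ b ^ k →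
                ∃ λ y → y ^ k ≈ x × (0# < z → 0# < y)
  divide-root k {x} {b} {z} 0<b zᵏ≈xbᵏ with pos-inverse 0<b
  ... | d , 0<d , bd≈1 = z ⊗ d , root , λ 0<z → *-pos 0<z 0<d
    where
    1^ : ∀ k → 1# ^ k ≈ 1#
    1^ zero    = refl
    1^ (suc k) = trans (*-identityˡ _) (1^ k)

    root : (z ⊗ d) ^ k ≈ x
    root = begin-equality
      (z ⊗ d) ^ k          ≈⟨ ^-distrib-* z d k ⟩
      z ^ k ⊗ d ^ k        ≈⟨ *-congʳ zᵏ≈xbᵏ ⟩
      (x ⊗ b ^ k) ⊗ d ^ k  ≈⟨ *-assoc x (b ^ k) (d ^ k) ⟩
      x ⊗ (b ^ k ⊗ d ^ k)  ≈⟨ *-congˡ (^-distrib-* b d k) ⟨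
      x ⊗ (b ⊗ d) ^ k      ≈⟨ *-congˡ (^-congˡ k bd≈1) ⟩
      x ⊗ 1# ^ k           ≈⟨ *-congˡ (1^ k) ⟩
      x ⊗ 1#               ≈⟨ *-identityʳ x ⟩
      x                    ∎

  large-nonpower : ∀ n .{{_ : NonZero n}} {x} → 0# < x → ¬ (∃ λ y → y ^ n ≈ x) →
                   ∃ λ a → 1# < a × ¬ HasPosRoot n a
  large-nonpower n {x} 0<x rootless with pos-inverse 0<x
  ... | d , 0<d , xd≈1 = x ⊗ b ^ n , <-*-^ n 1<b 0<x 1<xb , λ (z , _ , zⁿ≈xbⁿ) →
    let y , yⁿ≈x , _ = divide-root n (<-trans 0<1 1<b) zⁿ≈xbⁿ in rootless (y , yⁿ≈x)
    where
    -- Here `d` is the inverse of `x`, so that `x ⊗ b` is `x` plus one; the remaining factors of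
    -- `b ^ n` exceed `1#`.
    b : Carrier
    b = 1# ⊕ d

    1<b : 1# < b
    1<b = x<x+y 1# 0<d

    1<xb : 1# < x ⊗ b
    1<xb = begin-strict
      1#               <⟨ x<x+y 1# 0<x ⟩
      1# ⊕ x           ≈⟨ +-comm 1# x ⟩
      x ⊕ 1#           ≈⟨ +-cong (*-identityʳ x) xd≈1 ⟨
      x ⊗ 1# ⊕ x ⊗ d   ≈⟨ distribˡ x 1# d ⟨
      x ⊗ (1# ⊕ d)     ∎

  ExactDepth : ℕ → ℕ → Carrier → Set (c ⊔ ℓ ⊔ r)
  ExactDepth n i x = HasPosRoot (n ℕ.^ i) x × ¬ HasPosRoot (n ℕ.^ suc i) x

  -- As `n ^ suc i` divides `n ^ j`, depth `j` provides a root that depth `i` forbids.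
  exactDepth-disjoint-< : ∀ n {i j x} → i ℕ.< j → ExactDepth n i x → ¬ ExactDepth n j x
  exactDepth-disjoint-< n i<j (_ , rootless) (root , _) =
    rootless (HasPosRoot-∣ (^-monoʳ-∣ n i<j) root)

  exactDepth-unique : ∀ n {i j x} → i ≢ j → ExactDepth n i x → ¬ ExactDepth n j x
  exactDepth-unique n {i} {j} i≢j at-i at-j with ℕ.<-cmp i j
  ... | tri< i<j _ _ = exactDepth-disjoint-< n i<j at-i at-j
  ... | tri≈ _ i≡j _ = i≢j i≡j
  ... | tri> _ _ j<i = exactDepth-disjoint-< n j<i at-j at-i

  -- The factor `b ^ n` lifts `u` above `b` without making it an `n`th power. Since `a < b`, `u` is
  -- below `b ^ suc n`, and raising to the power `k` gives the upper bound. Its exponent depends on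
  -- `n` and `i` alone, so the claim is first-order for each `i`.
  exactDepth-in-interval :
    ∀ n .{{_ : NonZero n}} i {a b} → 1# < a → ¬ HasPosRoot n a → a < b →
    ∃ λ x → ExactDepth n i x × b < x × x < b ^ (suc n ℕ.* n ℕ.^ i)
  exactDepth-in-interval n i {a} {b} 1<a rootless a<b =
    u ^ k , ((u , 0<u , refl) , deeper-rootless) , <-^ k (<-trans 1<b b<u) b<u , upper
    where
    k : ℕ
    k = n ℕ.^ i

    instance
      k≢0 : NonZero k
      k≢0 = ℕ.m^n≢0 n i

    u : Carrier
    u = a ⊗ b ^ n

    1<b : 1# < b
    1<b = <-trans 1<a a<b

    0<a : 0# < a
    0<a = <-trans 0<1 1<a

    0<b : 0# < b
    0<b = <-trans 0<1 1<b

    b<u : b < u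
    b<u = <-*-^ n 1<b 0<a (y<x*y 1<a 0<b)

    0<u : 0# < u
    0<u = *-pos 0<a (^-pos n 0<b)

    deeper-rootless : ¬ HasPosRoot (n ℕ.^ suc i) (u ^ k)
    deeper-rootless (z , 0<z , z^nk≈uᵏ) =
      let y , yⁿ≈a , 0<y = divide-root n 0<b zⁿ≈u in rootless (y , 0<y 0<z , yⁿ≈a)
      where
      -- The outer exponent `k` cancels because both bases are positive; for `z ^ n` this rests on
      -- the positivity demanded by `HasPosRoot`.
      zⁿ≈u : z ^ n ≈ u
      zⁿ≈u = ^-injective k (^-pos n 0<z) 0<u (trans (^-assocʳ z n k) z^nk≈uᵏ)

    upper : u ^ k < b ^ (suc n ℕ.* k)
    upper = <-respʳ-≈ (^-assocʳ b (suc n) k)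
      (^-mono-< k 0<u (*-monoˡ-< (^-pos n 0<b) a<b))

-- Formulas and the sentences to be transferred.

infixl 9 _·_
infixl 8 _⊹_
infix  7 _≺_

_⊹_ _·_ : Term Lₒᵣ m → Term Lₒᵣ m → Term Lₒᵣ m
t ⊹ u = func plus (t ∷ u ∷ [])
t · u = func times (t ∷ u ∷ [])

_≺_ : Term Lₒᵣ m → Term Lₒᵣ m → Formula Lₒᵣ m
t ≺ u = rel less (t ∷ u ∷ [])

v₀ : Term Lₒᵣ (suc m)
v₀ = var zero

v₁ : Term Lₒᵣ (suc (suc m))
v₁ = var (suc zero)

v₂ : Term Lₒᵣ (suc (suc (suc m)))
v₂ = var (suc (suc zero))

-- The language has no constant 1, so exponent 0 is junk.
power : Term Lₒᵣ m → ℕ → Term Lₒᵣ m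
power t zero                = t
power t (suc zero)          = t
power t (suc k@(suc _))     = t · power t k

-- Without a constant 0, positivity of y is expressed as y < y + y.
positive : Formula Lₒᵣ (suc m)
positive = v₀ ≺ v₀ ⊹ v₀

hasPosRoot : ℕ → Formula Lₒᵣ (suc m)
hasPosRoot k = ∃' (positive ∧' power v₀ k ≐ v₁)

exactDepth : ℕ → ℕ → Formula Lₒᵣ (suc m)
exactDepth n i = hasPosRoot (n ℕ.^ i) ∧' ¬' hasPosRoot (n ℕ.^ suc i)

-- Without a constant 1, being greater than 1 becomes positivity together with `v₀ ≺ v₀ · v₀`; the
-- latter alone also holds for negative elements.
largeNonpower : ℕ → Formula Lₒᵣ (suc m)
largeNonpower n = positive ∧' (v₀ ≺ v₀ · v₀) ∧' ¬' hasPosRoot n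

between : Formula Lₒᵣ 3
between = v₁ ≺ v₀ ∧' v₀ ≺ v₂

abovePower : ℕ → Formula Lₒᵣ 2
abovePower k = power v₁ k ≺ v₀

<-irreflexivity <-transitivity <-directedness : Sentence Lₒᵣ
<-irreflexivity = ∀' ¬' (v₀ ≺ v₀)
<-transitivity  = ∀' ∀' ∀' (v₂ ≺ v₁ ⇒' v₁ ≺ v₀ ⇒' v₂ ≺ v₀)
<-directedness  = ∀' ∀' ∃' (v₂ ≺ v₀ ∧' v₁ ≺ v₀)

depth-disjointness depth-in-interval : ℕ → ℕ → ℕ → Sentence Lₒᵣ
depth-disjointness n i j = ∀' (exactDepth n i ⇒' ¬' exactDepth n j)
depth-in-interval n i k =
  ∀' (largeNonpower n ⇒' ∀' (v₁ ≺ v₀ ⇒' ∃' (exactDepth n i ∧' v₁ ≺ v₀ ∧' v₀ ≺ power v₁ k)))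

nonpower-existence : ℕ → Sentence Lₒᵣ
nonpower-existence n = ∃' largeNonpower n

module _ (M : Structure Lₒᵣ c ℓ r) where
  open Structure M

  -- For a variable `k` the term `power t k` does not reduce, so reading the same power in another
  -- assignment takes an induction on `k`.
  eval-power-cong : ∀ k {t : Term Lₒᵣ m} {u : Term Lₒᵣ m′} {ρ τ} →
                    eval M ρ t ≡ eval M τ u → eval M ρ (power t k) ≡ eval M τ (power u k)
  eval-power-cong zero            eq = eq
  eval-power-cong (suc zero)      eq = eq
  eval-power-cong (suc k@(suc _)) eq =
    ≡.cong₂ (λ x y → ⟦ times ⟧ᶠ (x ∷ y ∷ [])) eq (eval-power-cong k eq)

  hasPosRoot-local : ∀ k {x} {ρ : Vec Carrier m} {τ : Vec Carrier m′} →
                     Sat M (hasPosRoot k) (x ∷ ρ) → Sat M (hasPosRoot k) (x ∷ τ)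
  hasPosRoot-local k {x} (y , 0<y , lift yᵏ≈x) =
    y , 0<y , lift (≡.subst (_≈ x) (eval-power-cong k ≡.refl) yᵏ≈x)

  -- The transferred sentence speaks of depth in an assignment that also lists the interval's
  -- endpoint and the non-power; the pattern formula sees the point alone.
  exactDepth-local : ∀ n i {x} {ρ : Vec Carrier m} {τ : Vec Carrier m′} →
                     Sat M (exactDepth n i) (x ∷ ρ) → Sat M (exactDepth n i) (x ∷ τ)
  exactDepth-local n i (root , rootless) =
    hasPosRoot-local (n ℕ.^ i) root , rootless ∘ hasPosRoot-local (n ℕ.^ suc i)

-- Truth of the sentences in the field.

module OrderedFieldSatisfaction (F : OrderedField c ℓ r) where
  open OrderedField F
  open OrderedFieldProperties F

  private
    𝔽 : Structure Lₒᵣ c ℓ r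
    𝔽 = orderedFieldStructure F

  eval-power : ∀ k .{{_ : NonZero k}} {ρ : Vec Carrier m} t →
               eval 𝔽 ρ (power t k) ≈ eval 𝔽 ρ t ^ k
  eval-power (suc zero)      t = sym (*-identityʳ _)
  eval-power (suc k@(suc _)) t = *-congˡ (eval-power k t)

  hasPosRoot⇔ : ∀ k .{{_ : NonZero k}} {x} {ρ : Vec Carrier m} →
                Sat 𝔽 (hasPosRoot k) (x ∷ ρ) ⇔ HasPosRoot k x
  hasPosRoot⇔ k = mk⇔
    (λ (y , lift y<y+y , lift yᵏ≈x) →
       y , x<x+x⇒0< y<y+y , trans (sym (eval-power k v₀)) yᵏ≈x)
    (λ (y , 0<y , yᵏ≈x) →
       y , lift (0<⇒x<x+x 0<y) , lift (trans (eval-power k v₀) yᵏ≈x))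

  module _ (n : ℕ) .{{_ : NonZero n}} where
    exactDepth⇔ : ∀ i {x} {ρ : Vec Carrier m} →
                  Sat 𝔽 (exactDepth n i) (x ∷ ρ) ⇔ ExactDepth n i x
    exactDepth⇔ i = mk⇔
      (λ (root , rootless) → to (root⇔ i) root , rootless ∘ from (root⇔ (suc i)))
      (λ (root , rootless) → from (root⇔ i) root , rootless ∘ to (root⇔ (suc i)))
      where
      open Equivalence
      root⇔ : ∀ j {x} {ρ : Vec Carrier m} →
              Sat 𝔽 (hasPosRoot (n ℕ.^ j)) (x ∷ ρ) ⇔ HasPosRoot (n ℕ.^ j) x
      root⇔ j = hasPosRoot⇔ (n ℕ.^ j) {{ℕ.m^n≢0 n j}}

    sat-depth-disjointness : ∀ {i j} → i ≢ j → Sat 𝔽 (depth-disjointness n i j) []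
    sat-depth-disjointness {i} {j} i≢j x at-i at-j =
      exactDepth-unique n i≢j (to (exactDepth⇔ i) at-i) (to (exactDepth⇔ j) at-j)
      where open Equivalence

    sat-depth-in-interval : ∀ i → Sat 𝔽 (depth-in-interval n i (suc n ℕ.* n ℕ.^ i)) []
    sat-depth-in-interval i a (lift a<a+a , lift a<aa , rootless) b (lift a<b) =
      let x , depth , b<x , x<bᵏ = exactDepth-in-interval n i
            (x<x*x⇒1< (x<x+x⇒0< a<a+a) a<aa) (rootless ∘ from (hasPosRoot⇔ n)) a<b
      in x , from (exactDepth⇔ i) depth , lift b<x ,
         lift (<-respʳ-≈ (sym (eval-power k {{k≢0}} v₁)) x<bᵏ)
      where
      open Equivalence
      k : ℕ
      k = suc n ℕ.* n ℕ.^ i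
      k≢0 : NonZero k
      k≢0 = ℕ.m*n≢0 (suc n) (n ℕ.^ i) {{_}} {{ℕ.m^n≢0 n i}}

    sat-nonpower-existence : ∀ {x} → 0# < x → ¬ (∃ λ y → y ^ n ≈ x) →
                             Sat 𝔽 (nonpower-existence n) []
    sat-nonpower-existence 0<x rootless =
      let a , 1<a , a-rootless = large-nonpower n 0<x rootless
          0<a = <-trans 0<1 1<a
      in a , lift (0<⇒x<x+x 0<a) , lift (y<x*y 1<a 0<a) ,
         a-rootless ∘ Equivalence.to (hasPosRoot⇔ n)

  sat-<-irreflexivity : Sat 𝔽 <-irreflexivity []
  sat-<-irreflexivity x (lift x<x) = irrefl refl x<x

  sat-<-transitivity : Sat 𝔽 <-transitivity []
  sat-<-transitivity x y z (lift x<y) (lift y<z) = lift (<-trans x<y y<z)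

  sat-<-directedness : Sat 𝔽 <-directedness []
  sat-<-directedness x y =
    let z , x<z , y<z = upward-directed x y in z , lift x<z , lift y<z

-- The pattern in the monster model.

module _ {F : OrderedField c ℓ r}
         (𝒰 : MonsterModel (Th (orderedFieldStructure F)) s c′ ℓ′ r′) where
  open MonsterModel 𝒰
  open OrderedFieldSatisfaction F

  private
    infix 4 _<ᵁ_
    _<ᵁ_ : Carrier → Carrier → Set r′
    x <ᵁ y = ⟦ less ⟧ʳ (x ∷ y ∷ [])

    _^ᵁ_ : Carrier → ℕ → Carrier
    b ^ᵁ k = eval structure (b ∷ []) (power v₀ k)

  <ᵁ-irrefl : ∀ {x} → ¬ (x <ᵁ x)
  <ᵁ-irrefl {x} x<x = models {<-irreflexivity} sat-<-irreflexivity x (lift x<x)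

  <ᵁ-trans : ∀ {x y z} → x <ᵁ y → y <ᵁ z → x <ᵁ z
  <ᵁ-trans {x} {y} {z} x<y y<z = lower (models {<-transitivity} sat-<-transitivity x y z (lift x<y) (lift y<z))

  <ᵁ-directed : ∀ x y → ∃ λ z → x <ᵁ z × y <ᵁ z
  <ᵁ-directed x y =
    let z , lift x<z , lift y<z = models {<-directedness} sat-<-directedness x y in z , x<z , y<z

  -- Saturation for the type, over the single parameter `b`, of an element above every power of `b`.
  -- Finitely many powers have a common strict upper bound by directedness.
  above-all-powers : ∀ b → ∃ λ x → ∀ k → b ^ᵁ k <ᵁ x
  above-all-powers b with saturated v π consistent
    where
    v : Lift s ⊤ → Carrier
    v _ = b

    π : PartialType Lₒᵣ (Lift s ⊤) 1 s
    π χ = ∃ λ k → χ ≡ abovePower k ⟨ lift tt ∷ [] ⟩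

    -- A threshold beyond which everything satisfies `Γ`, rather than one solution: a further
    -- formula is then met by raising the threshold.
    eventually : ∀ Γ → All (instantiate structure v π) Γ →
                 ∃ λ z → ∀ x → z <ᵁ x → All (Satisfies structure (x ∷ [])) Γ
    eventually [] [] = b , λ _ _ → []
    eventually (_ ∷ Γ) ((_ , (k , ≡.refl) , ≡.refl) ∷ Γ⊆π) =
      let z , above-z = eventually Γ Γ⊆π
          w , z<w , bᵏ<w = <ᵁ-directed z (b ^ᵁ k)
      in w , λ x w<x →
        lift (≡.subst (_<ᵁ x) (eval-power-cong structure k ≡.refl) (<ᵁ-trans bᵏ<w w<x))
        ∷ above-z x (<ᵁ-trans z<w w<x)

    consistent : Consistent structure (instantiate structure v π)
    consistent Γ Γ⊆π =
      let z , above-z = eventually Γ Γ⊆π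
          x , z<x , _ = <ᵁ-directed z z
      in x ∷ [] , above-z x z<x
  ... | x ∷ [] , realizes = x , λ k →
    ≡.subst (_<ᵁ x) (eval-power-cong structure k ≡.refl)
      (lower (realizes (_ , (k , ≡.refl) , ≡.refl)))

  module _ (n : ℕ) .{{_ : NonZero n}} {a} (a-large : Sat structure (largeNonpower n) (a ∷ [])) where
    private
      next : Carrier → Carrier
      next b = proj₁ (above-all-powers b)

      bound : ℕ → Carrier
      -- The square of `a` lies above `a` by `a-large`, as `point` requires.
      bound zero    = ⟦ times ⟧ᶠ (a ∷ a ∷ [])
      bound (suc j) = next (bound j)

      -- The transferred upper bound is a power of `b` whose exponent grows with `i`; `next b`
      -- exceeds all these powers, so one interval serves every depth.
      point : ∀ i {b} → a <ᵁ b →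
              ∃ λ x → Sat structure (exactDepth n i) (x ∷ []) × b <ᵁ x × x <ᵁ next b
      point i {b} a<b =
        let x , depth , lift b<x , lift x<bᵏ =
              models {depth-in-interval n i k} (sat-depth-in-interval n i) a a-large b (lift a<b)
        in x , exactDepth-local structure n i depth , b<x ,
           <ᵁ-trans (≡.subst (x <ᵁ_) (eval-power-cong structure k ≡.refl) x<bᵏ)
             (proj₂ (above-all-powers b) k)
        where
        k : ℕ
        k = suc n ℕ.* n ℕ.^ i

      a<bound : ∀ j → a <ᵁ bound j
      a<bound zero    = lower (proj₁ (proj₂ a-large))
      a<bound (suc j) =
        -- Depth 0 is an arbitrary choice: any point of the interval shows that its endpoints are in
        -- increasing order.
        let _ , _ , b<x , x<next = point 0 (a<bound j)
        in <ᵁ-trans (a<bound j) (<ᵁ-trans b<x x<next)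

      bound-mono : ∀ {i j} → i ℕ.<′ j → bound i <ᵁ bound j
      bound-mono {i} ℕ.≤′-refl =
        let _ , _ , b<x , x<next = point 0 (a<bound i) in <ᵁ-trans b<x x<next
      bound-mono (ℕ.≤′-step {j} i<j) = <ᵁ-trans (bound-mono i<j) (bound-mono {j} ℕ.≤′-refl)

      intervals-disjoint-< : ∀ {i j x} → i ℕ.< j → x <ᵁ bound (suc i) → ¬ (bound j <ᵁ x)
      -- Adjacent intervals share an endpoint, to which the strict `bound-mono` does not apply, so
      -- they form a separate case.
      intervals-disjoint-< i<j x<bᵢ₊₁ bⱼ<x with ℕ.m<1+n⇒m<n∨m≡n (ℕ.s≤s i<j)
      ... | inj₁ i+1<j  = <ᵁ-irrefl
              (<ᵁ-trans x<bᵢ₊₁ (<ᵁ-trans (bound-mono (ℕ.<⇒<′ i+1<j)) bⱼ<x))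
      ... | inj₂ ≡.refl = <ᵁ-irrefl (<ᵁ-trans x<bᵢ₊₁ bⱼ<x)

      intervals-disjoint : ∀ {i j x} → i ≢ j → bound i <ᵁ x → x <ᵁ bound (suc i) →
                           ¬ (bound j <ᵁ x × x <ᵁ bound (suc j))
      intervals-disjoint {i} {j} i≢j bᵢ<x x<bᵢ₊₁ (bⱼ<x , x<bⱼ₊₁) with ℕ.<-cmp i j
      ... | tri< i<j _ _ = intervals-disjoint-< i<j x<bᵢ₊₁ bⱼ<x
      ... | tri≈ _ i≡j _ = i≢j i≡j
      ... | tri> _ _ j<i = intervals-disjoint-< j<i x<bⱼ₊₁ bᵢ<x

    largeNonpower⇒dpPattern :
      DpPattern 𝒰 {k = 1} ｛ (var zero ≐ var zero) ⟨ [] ⟩ ｝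
    largeNonpower⇒dpPattern = record
      { φ = λ i → exactDepth n i ⟨ [] ⟩
      ; ψ = between
      ; b = λ j → bound j ∷ bound (suc j) ∷ []
      ; consistent = λ i₀ j₀ Γ Γ⊆π →
          -- This one point realizes the entire type, hence each finite part `Γ` of it.
          let x , depth , b<x , x<b = point i₀ (a<bound j₀) in
          x ∷ [] , All.map (λ
            { (inj₁ ≡.refl) → lift (Setoid.refl setoid)
            ; (inj₂ (inj₁ ≡.refl)) → depth
            ; (inj₂ (inj₂ (inj₁ ≡.refl))) → lift b<x , lift x<b
            ; (inj₂ (inj₂ (inj₂ (inj₁ (i , i≢i₀ , ≡.refl))))) →
                models {depth-disjointness n i₀ i} (sat-depth-disjointness n (i≢i₀ ∘ ≡.sym)) x depth
            ; (inj₂ (inj₂ (inj₂ (inj₂ (j , j≢j₀ , ≡.refl))))) (lift bⱼ<x , lift x<bⱼ₊₁) →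
                intervals-disjoint (j≢j₀ ∘ ≡.sym) b<x x<b (bⱼ<x , x<bⱼ₊₁)
            }) Γ⊆π
      }

theorem1p6 : ∀ {c ℓ r s c′ ℓ′ r′} → (∀ {a} → ExcludedMiddle a) →
    (F : OrderedField c ℓ r) (𝒰 : MonsterModel (Th (orderedFieldStructure F)) s c′ ℓ′ r′) →
    DpSmall 𝒰 →
    let open OrderedField F in
    (n : ℕ) → .{{NonZero n}} → (x : Carrier) → 0# < x → ∃ λ y → y ^ n ≈ x
theorem1p6 em F 𝒰 small n x 0<x with em
... | yes root    = root
... | no rootless =
  -- No embedding of `F` into `𝒰` is given, so the existence of a large non-power is transferred as
  -- a sentence and `a` is a fresh witness in `𝒰`.
  let a , a-large = MonsterModel.models 𝒰 {nonpower-existence n}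
        (OrderedFieldSatisfaction.sat-nonpower-existence F n 0<x rootless)
  in contradiction (largeNonpower⇒dpPattern 𝒰 n a-large) small
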